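{- There exists a function $\omega:\mathbb{N}\to[0,\infty)$ with $\omega(n)\to0$ as $n\to\infty$ such that the following holds. Let $G$ be a group, let $S,T,X$ be nonempty finite subsets of $G$, and let $Z=XST$. Then there exist subsets $S'\subseteq S$ and $T'\subseteq T$ with $(S'T)\cup(ST')=ST$ and \[ |S'|,|T'|\le \omega(|Z|)\,\frac{|Z|^2}{|X|}. \]
   Context: For subsets of a group, $XY=\{xy:x\in X,y\in Y\}$ and $XST=\{xst:x\in X,s\in S,t\in T\}$. (The paper writes the bound as $|S'|,|T'|=o(|Z|^2/|X|)$.) -}

module Defs where

open import Level using (Level; _⊔_; Setω)
open import Data.Nat using (ℕ; _≤_)
open import Data.Integer using (+_)
open import Data.Rational using (ℚ; _/_; 0ℚ) renaming (_≤_ to _≤ℚ_; _<_ to _<ℚ_; _*_ to _*ℚ_)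
open import Data.List using (List; []; length)
open import Data.Product using (Σ; Σ-syntax; _×_)
open import Data.Sum using (_⊎_)
open import Relation.Nullary using (¬_)
open import Relation.Binary.PropositionalEquality using (_≡_)
open import Algebra.Bundles using (Group)

ℕ→ℚ : ℕ → ℚ
ℕ→ℚ n = (+ n) / 1

-- Finite subsets of a group G (up to the group's equality ≈) are
-- represented as duplicate-free lists; the cardinality is the length.
module GroupSets {c ℓ : Level} (G : Group c ℓ) where
  open Group G public
  open import Data.List.Membership.Setoid setoid public using (_∈_)
  open import Data.List.Relation.Unary.Unique.Setoid setoid public using (Unique)

  record FinSubset : Set (c ⊔ ℓ) where
    constructor finSubset
    field
      elems  : List Carrier
      unique : Unique elems

  open FinSubset public

  _∈ₛ_ : Carrier → FinSubset → Set (c ⊔ ℓ)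
  g ∈ₛ A = g ∈ elems A

  ∣_∣ : FinSubset → ℕ
  ∣ A ∣ = length (elems A)

  NonemptySet : FinSubset → Set c
  NonemptySet A = ¬ (elems A ≡ [])

  _⊆ₛ_ : FinSubset → FinSubset → Set (c ⊔ ℓ)
  A ⊆ₛ B = ∀ g → g ∈ₛ A → g ∈ₛ B

  InProd : FinSubset → FinSubset → Carrier → Set (c ⊔ ℓ)
  InProd A B g = Σ[ a ∈ Carrier ] Σ[ b ∈ Carrier ] (a ∈ₛ A × b ∈ₛ B × g ≈ a ∙ b)

  InProd3 : FinSubset → FinSubset → FinSubset → Carrier → Set (c ⊔ ℓ)
  InProd3 X S T g = Σ[ x ∈ Carrier ] Σ[ s ∈ Carrier ] Σ[ t ∈ Carrier ]
                      (x ∈ₛ X × s ∈ₛ S × t ∈ₛ T × g ≈ (x ∙ s) ∙ t)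

  IsSetOf : FinSubset → (Carrier → Set (c ⊔ ℓ)) → Set (c ⊔ ℓ)
  IsSetOf Z P = ∀ g → (g ∈ₛ Z → P g) × (P g → g ∈ₛ Z)

  -- |A| ≤ w · |Z|² / |X|, written without division (|X| > 0):
  -- |A| · |X| ≤ w · |Z|²
  Bound : ℚ → FinSubset → FinSubset → FinSubset → Set
  Bound w A Z X = ℕ→ℚ ∣ A ∣ *ℚ ℕ→ℚ ∣ X ∣ ≤ℚ w *ℚ (ℕ→ℚ ∣ Z ∣ *ℚ ℕ→ℚ ∣ Z ∣)

  Conclusion : (ℕ → ℚ) → Set (c ⊔ ℓ)
  Conclusion ω =
    (S T X : FinSubset) → NonemptySet S → NonemptySet T → NonemptySet X →
    (Z : FinSubset) → IsSetOf Z (InProd3 X S T) →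
    Σ[ S' ∈ FinSubset ] Σ[ T' ∈ FinSubset ]
      ( S' ⊆ₛ S × T' ⊆ₛ T
      × (∀ g → ((InProd S' T g ⊎ InProd S T' g) → InProd S T g)
             × (InProd S T g → (InProd S' T g ⊎ InProd S T' g)))
      × Bound (ω ∣ Z ∣) S' Z X
      × Bound (ω ∣ Z ∣) T' Z X )

NonNeg : (ℕ → ℚ) → Set
NonNeg ω = ∀ n → 0ℚ ≤ℚ ω n

TendsToZero : (ℕ → ℚ) → Set
TendsToZero ω = ∀ ε → 0ℚ <ℚ ε → Σ[ N ∈ ℕ ] (∀ n → N ≤ n → ω n ≤ℚ ε)

record ∃Omega : Setω where
  constructor mkOmega
  field
    ω    : ℕ → ℚ
    nonneg : NonNeg ω
    tends  : TendsToZero ω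
    holds  : ∀ {c ℓ : Level} (G : Group c ℓ) → GroupSets.Conclusion G ω

{-# OPTIONS --safe #-}

-- Run through the pairs (s , t) in S × T and keep a pair when s t is not yet in S′T ∪ ST′, where
-- S′ and T′ consist of the coordinates of the pairs kept so far. The kept pairs (s_l , t_l) give a
-- cover, and s_j t_k = s_i t_i is impossible when j was kept before i.
--
-- Consider the bipartite graph on XS and Z with the edges (x s_l , x s_l t_l). They are distinct for
-- distinct (x , l), and (x s_j , x s_i t_i) is not an edge when j was kept before i. Partition both
-- sides into boundedly many classes so that all but |Z|²/q of the pairs of vertices lie in cells
-- (B , C) which contain no edge at all or have no edgeless P × Q with |P| ≥ |B|/q and |Q| ≥ |C|/q.
-- Such a partition is found by splitting classes along the holes P, Q: each round enlarges the
-- total area of the edgeless cells by at least |Z|²/q³.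
--
-- If l is neither among the first |B|/q indices j with x s_j in B nor among the last |C|/q indices
-- i with x s_i t_i in C, where (x s_l , x s_l t_l) lies in the cell (B , C), then the order condition
-- makes a hole in (B , C). Hence the |X| n edges, n the number of kept pairs, number at most
-- |Z|²/q + 2|X|(|Z|/q + O_q(1)).
module Submission where

open import Algebra.Bundles using (Group)
import Algebra.Properties.Group as GroupProperties
open import Data.Bool using (if_then_else_)
open import Data.Fin as Fin using (Fin; zero; suc; _≟_; combine; remQuot; _↑ˡ_; _↑ʳ_)
open import Data.Fin.Properties as Fin using (any?; all?)
open import Data.Fin.Subset using (Subset; _∈_; ⊥)
open import Data.Fin.Subset.Properties using (_∈?_; anySubset?)
open import Data.Integer as ℤ using (+≤+) renaming (+_ to pos)
import Data.Integer.Properties as ℤ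
open import Data.List using (List; []; _∷_; length; map; lookup; allFin; cartesianProduct)
open import Data.List.Membership.Propositional using (find; lose) renaming (_∈_ to _∈ₗ_)
open import Data.List.Membership.Propositional.Properties using (∈-allFin; ∈-cartesianProduct⁺)
open import Data.List.Membership.Setoid.Properties using (∈-lookup; ∈-resp-≈)
open import Data.List.Properties using (length-map)
open import Data.List.Relation.Unary.All as All using (All; []; _∷_)
open import Data.List.Relation.Unary.All.Properties using (¬Any⇒All¬)
open import Data.List.Relation.Unary.AllPairs as AllPairs using (AllPairs; []; _∷_)
import Data.List.Relation.Unary.AllPairs.Properties as AllPairs
open import Data.List.Relation.Unary.Any as Any using (Any; here; there; index)
open import Data.List.Relation.Unary.Any.Properties as Any using (lookup-index)
open import Data.Nat hiding (_≟_)
open import Data.Nat.DivMod using (m≡m%n+[m/n]*n; m%n≤n; m/n*n≤m)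
open import Data.Nat.Properties hiding (_≟_)
open import Data.Nat.Tactic.RingSolver using (solve-∀)
open import Data.Product hiding (map)
open import Data.Rational as ℚ using (ℚ; 0ℚ; mkℚ; toℚᵘ)
import Data.Rational.Properties as ℚ
open import Data.Rational.Unnormalised as ℚᵘ using (mkℚᵘ; _≃_; *≤*)
import Data.Rational.Unnormalised.Properties as ℚᵘ
open import Data.Sum using (_⊎_; inj₁; inj₂)
open import Data.Vec using (tabulate)
open import Data.Vec.Properties using (lookup∘tabulate; []=⇒lookup; lookup⇒[]=)
open import Function using (_∘_; case_of_; it)
open import Level using (Level)
open import Relation.Binary.Definitions using (tri<; tri≈; tri>)
open import Relation.Binary.PropositionalEquality as ≡
  using (_≡_; refl; sym; trans; cong; cong₂; subst; subst₂; module ≡-Reasoning)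
open import Relation.Nullary
open import Relation.Nullary.Decidable using (dec-true)

open import Algebra.Properties.Semiring.Sum +-*-semiring
open import Defs

private variable
  A B : Set
  k m n p : ℕ

-- Indicator sums and counting over finite index sets.

⟦_⟧ : Dec A → ℕ
⟦ a? ⟧ = if does a? then 1 else 0

⟦⟧-yes : (a? : Dec A) → A → ⟦ a? ⟧ ≡ 1
⟦⟧-yes (yes _) _ = refl
⟦⟧-yes (no ¬a) a = contradiction a ¬a

⟦⟧-no : (a? : Dec A) → ¬ A → ⟦ a? ⟧ ≡ 0
⟦⟧-no (yes a) ¬a = contradiction a ¬a
⟦⟧-no (no _) _ = refl

⟦⟧≤1 : (a? : Dec A) → ⟦ a? ⟧ ≤ 1
⟦⟧≤1 (yes _) = ≤-refl
⟦⟧≤1 (no _)  = z≤n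

⟦⟧-mono : (a? : Dec A) (b? : Dec B) → (A → B) → ⟦ a? ⟧ ≤ ⟦ b? ⟧
⟦⟧-mono (yes a) b? f = ≤-reflexive (sym (⟦⟧-yes b? (f a)))
⟦⟧-mono (no _)  b? f = z≤n

⟦⟧-× : (a? : Dec A) (b? : Dec B) → ⟦ a? ×-dec b? ⟧ ≡ ⟦ a? ⟧ * ⟦ b? ⟧
⟦⟧-× (yes _) b? = sym (+-identityʳ ⟦ b? ⟧)
⟦⟧-× (no _)  b? = refl

∑-mono : {f g : Fin n → ℕ} → (∀ i → f i ≤ g i) → ∑[ i < n ] f i ≤ ∑[ i < n ] g i
∑-mono {zero}  f≤g = z≤n
∑-mono {suc n} f≤g = +-mono-≤ (f≤g zero) (∑-mono (f≤g ∘ suc))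

∑-const : ∀ n c → ∑[ i < n ] c ≡ n * c
∑-const zero    c = refl
∑-const (suc n) c = cong (c +_) (∑-const n c)

∑-zero : {f : Fin n → ℕ} → (∀ i → f i ≡ 0) → ∑[ i < n ] f i ≡ 0
∑-zero {n} f≡0 = trans (sum-cong-≗ f≡0) (trans (∑-const n 0) (*-zeroʳ n))

∑-product : (f : Fin m → ℕ) (g : Fin n → ℕ) →
            ∑[ i < m ] ∑[ j < n ] (f i * g j) ≡ ∑[ i < m ] f i * ∑[ j < n ] g j
∑-product f g = trans (sum-cong-≗ λ i → sym (*-distribˡ-sum (f i) g)) (sym (*-distribʳ-sum _ f))

∑-combine : ∀ m n (f : Fin (m * n) → ℕ) →
            ∑[ k < m * n ] f k ≡ ∑[ i < m ] ∑[ j < n ] f (combine i j)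
∑-combine zero    n f = refl
∑-combine (suc m) n f = trans (split n f) (cong (∑[ j < n ] f (j ↑ˡ m * n) +_) (∑-combine m n (f ∘ (n ↑ʳ_))))
  where
  split : ∀ n {p} (f : Fin (n + p) → ℕ) →
          ∑[ k < n + p ] f k ≡ ∑[ j < n ] f (j ↑ˡ p) + ∑[ j < p ] f (n ↑ʳ j)
  split zero    f = refl
  split (suc n) f = trans (cong (f zero +_) (split n (f ∘ suc))) (sym (+-assoc (f zero) _ _))

∑-δ : (a : Fin k) (g : Fin k → ℕ) → ∑[ b < k ] (⟦ a ≟ b ⟧ * g b) ≡ g a
∑-δ zero    g = trans (cong₂ _+_ (+-identityʳ (g zero)) (∑-zero {f = λ b → ⟦ zero ≟ suc b ⟧ * g (suc b)} λ _ → refl)) (+-identityʳ (g zero))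
∑-δ (suc a) g = ∑-δ a (g ∘ suc)

∑-fibres : (c : Fin n → Fin k) (g : Fin k → Fin n → ℕ) →
           ∑[ i < n ] g (c i) i ≡ ∑[ b < k ] ∑[ i < n ] (⟦ c i ≟ b ⟧ * g b i)
∑-fibres c g = trans (sum-cong-≗ λ i → sym (∑-δ (c i) λ b → g b i)) (∑-comm λ i b → ⟦ c i ≟ b ⟧ * g b i)

-- This turns an area, that is a sum over pairs of vertices, into a sum over the cells of a
-- partition; within a cell the colour arguments of `g` are fixed.
∑-fibres₂ : (c : Fin m → Fin k) (d : Fin n → Fin p) (g : Fin k → Fin p → Fin m → Fin n → ℕ) →
            ∑[ i < m ] ∑[ j < n ] g (c i) (d j) i j ≡
            ∑[ b < k ] ∑[ e < p ] ∑[ i < m ] ∑[ j < n ] (⟦ c i ≟ b ⟧ * (⟦ d j ≟ e ⟧ * g b e i j))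
∑-fibres₂ {m} {k} {n} {p} c d g = trans (∑-fibres c λ b i → ∑[ j < n ] g b (d j) i j) (sum-cong-≗ λ b → trans
  (sum-cong-≗ λ i → trans (cong (⟦ c i ≟ b ⟧ *_) (∑-fibres d λ e j → g b e i j))
    (trans (*-distribˡ-sum ⟦ c i ≟ b ⟧ λ e → ∑[ j < n ] (⟦ d j ≟ e ⟧ * g b e i j))
      (sum-cong-≗ λ e → *-distribˡ-sum ⟦ c i ≟ b ⟧ λ j → ⟦ d j ≟ e ⟧ * g b e i j)))
  (∑-comm λ i e → ∑[ j < n ] (⟦ c i ≟ b ⟧ * (⟦ d j ≟ e ⟧ * g b e i j))))

count : {P : Fin n → Set} → (∀ i → Dec (P i)) → ℕ
count {n} P? = ∑[ i < n ] ⟦ P? i ⟧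

count-unique : {P : Fin n → Set} (P? : ∀ i → Dec (P i)) → (∀ {i j} → P i → P j → i ≡ j) → count P? ≤ 1
count-unique {zero}  P? uniq = z≤n
count-unique {suc n} P? uniq with P? zero
... | yes p = s≤s (≤-reflexive (∑-zero λ i → ⟦⟧-no (P? (suc i)) λ p′ → contradiction (uniq p p′) λ ()))
... | no _  = count-unique (P? ∘ suc) λ p p′ → Fin.suc-injective (uniq p p′)

-- Grouping the left side by the value of `φ` gives `f j` the number of preimages of `j` as its
-- coefficient, and injectivity caps this at 1.
∑-injective : {φ : Fin m → Fin n} → (∀ {i j} → φ i ≡ φ j → i ≡ j) → (f : Fin n → ℕ) →
              ∑[ i < m ] f (φ i) ≤ ∑[ j < n ] f j
∑-injective {m} {n} {φ} inj f = begin
  ∑[ i < m ] f (φ i)                           ≡⟨ ∑-fibres φ (λ b _ → f b) ⟩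
  ∑[ j < n ] ∑[ i < m ] (⟦ φ i ≟ j ⟧ * f j)    ≡⟨ sum-cong-≗ (λ j → sym (*-distribʳ-sum (f j) λ i → ⟦ φ i ≟ j ⟧)) ⟩
  ∑[ j < n ] (count (λ i → φ i ≟ j) * f j)     ≤⟨ ∑-mono (λ j → *-monoˡ-≤ (f j)
                                                   (count-unique (λ i → φ i ≟ j) λ p q → inj (trans p (sym q)))) ⟩
  ∑[ j < n ] (1 * f j)                         ≡⟨ sum-cong-≗ (λ j → *-identityˡ (f j)) ⟩
  ∑[ j < n ] f j                               ∎
  where open ≤-Reasoning

∑-injective₂ : ∀ {a} {y : Fin a → Fin n → Fin m} {z : Fin a → Fin n → Fin p} →
               (∀ {i j i′ j′} → y i j ≡ y i′ j′ → z i j ≡ z i′ j′ → i ≡ i′ × j ≡ j′) →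
               (f : Fin m → Fin p → ℕ) →
               ∑[ i < a ] ∑[ j < n ] f (y i j) (z i j) ≤ ∑[ u < m ] ∑[ v < p ] f u v
∑-injective₂ {n} {m} {p} {a} {y} {z} inj f = begin
  ∑[ i < a ] ∑[ j < n ] f (y i j) (z i j)            ≡⟨ sum-cong-≗ (λ i → sum-cong-≗ λ j → sym (F-combine i j)) ⟩
  ∑[ i < a ] ∑[ j < n ] F (φ (combine i j))          ≡⟨ ∑-combine a n (F ∘ φ) ⟨
  ∑[ k < a * n ] F (φ k)                             ≤⟨ ∑-injective φ-injective F ⟩
  ∑[ k < m * p ] F k                                 ≡⟨ ∑-combine m p F ⟩
  ∑[ u < m ] ∑[ v < p ] F (combine u v)              ≡⟨ sum-cong-≗ (λ u → sum-cong-≗ λ v → cong (uncurry f) (Fin.remQuot-combine u v)) ⟩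
  ∑[ u < m ] ∑[ v < p ] f u v                        ∎
  where
  open ≤-Reasoning
  F : Fin (m * p) → ℕ
  F k = uncurry f (remQuot p k)
  ψ : Fin a × Fin n → Fin (m * p)
  ψ (i , j) = combine (y i j) (z i j)
  φ : Fin (a * n) → Fin (m * p)
  φ k = ψ (remQuot n k)
  F-combine : ∀ i j → F (φ (combine i j)) ≡ f (y i j) (z i j)
  F-combine i j = trans (cong (F ∘ ψ) (Fin.remQuot-combine i j)) (cong (uncurry f) (Fin.remQuot-combine (y i j) (z i j)))
  φ-injective : ∀ {k l} → φ k ≡ φ l → k ≡ l
  φ-injective {k} {l} eq =
    let ys , zs = Fin.combine-injective _ _ _ _ eq
        is , js = inj ys zs
    in trans (sym (Fin.combine-remQuot {a} n k)) (trans (cong₂ combine is js) (Fin.combine-remQuot {a} n l))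

module _ {P : Fin n → Set} (P? : ∀ i → Dec (P i)) where

  #before #after : Fin n → ℕ
  #before i = count λ j → (j Fin.<? i) ×-dec P? j
  #after  i = count λ j → (i Fin.<? j) ×-dec P? j

-- If the first index is late, fewer than `C` members of `P` follow it, so at most `C` indices are
-- counted in all. Otherwise it drops out, and lateness in the tail is unchanged because it looks
-- only forward.
count-late : {P : Fin n → Set} (P? : ∀ i → Dec (P i)) (C : ℕ) →
             count (λ i → P? i ×-dec (#after P? i <? C)) ≤ C
count-late {zero}  P? C = z≤n
count-late {suc n} {P} P? C = bound (P? zero ×-dec (#after P? zero <? C))
  where
  P?₊ = λ i → P? (suc i)
  late? : ∀ i → Dec (P i × #after P? i < C)
  late? i = P? i ×-dec (#after P? i <? C)
  bound : Dec (P zero × #after P? zero < C) → count late? ≤ C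
  bound (no ¬l)       = +-mono-≤ (≤-reflexive (⟦⟧-no (late? zero) ¬l)) (count-late P?₊ C)
  bound (yes (_ , l)) = ≤-trans
    (+-mono-≤ (⟦⟧≤1 (late? zero)) (∑-mono λ i → ⟦⟧-mono (late? (suc i)) (P?₊ i) proj₁)) l

-- Earliness looks backward, so an induction from the front has to remember how many members of `P`
-- it has passed; this is `r`. Each member met uses up one unit of `C ∸ r`, and once `r` reaches `C`
-- no further index is early.
count-early-from : {P : Fin n → Set} (P? : ∀ i → Dec (P i)) (C r : ℕ) →
                   count (λ i → P? i ×-dec (r + #before P? i <? C)) ≤ C ∸ r
count-early-from {zero}  P? C r = z≤n
count-early-from {suc n} {P} P? C r = bound (P? zero)
  where
  open ≤-Reasoning
  P?₊ = λ i → P? (suc i)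
  rest : ∀ s → (∀ i → s + #before P?₊ i ≤ r + #before P? (suc i)) →
         count (λ i → P?₊ i ×-dec (r + #before P? (suc i) <? C)) ≤ C ∸ s
  rest s s≤ = ≤-trans
    (∑-mono λ i → ⟦⟧-mono (P?₊ i ×-dec (_ <? C)) (P?₊ i ×-dec (s + #before P?₊ i <? C)) λ (p , lt) → p , ≤-<-trans (s≤ i) lt)
    (count-early-from P?₊ C s)
  at-zero : r + #before P? zero ≡ r
  at-zero = trans (cong (r +_) (∑-zero {f = λ j → ⟦ (j Fin.<? zero {n}) ×-dec P? j ⟧} λ _ → refl)) (+-identityʳ r)
  bound : Dec (P zero) → count (λ i → P? i ×-dec (r + #before P? i <? C)) ≤ C ∸ r
  bound (no ¬p) = +-mono-≤
    (≤-reflexive (⟦⟧-no (P? zero ×-dec (r + #before P? zero <? C)) λ (p , _) → ¬p p))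
    (rest r λ i → +-monoʳ-≤ r (m≤n+m _ _))
  bound (yes p) with r <? C
  ... | yes r<C = begin
    count (λ i → P? i ×-dec (r + #before P? i <? C)) ≤⟨ +-mono-≤ (⟦⟧≤1 (P? zero ×-dec (r + #before P? zero <? C))) (rest (suc r) after-p) ⟩
    1 + (C ∸ suc r)                                  ≡⟨ +-∸-assoc 1 r<C ⟨
    C ∸ r                                            ∎
    where
    after-p : ∀ i → suc r + #before P?₊ i ≤ r + #before P? (suc i)
    after-p i = ≤-reflexive (trans (sym (+-suc r _)) (cong (λ h → r + (h + #before P?₊ i)) (sym (⟦⟧-yes (P? zero) p))))
  ... | no r≮C = +-mono-≤
    (≤-reflexive (⟦⟧-no (P? zero ×-dec (r + #before P? zero <? C)) λ (_ , lt) → r≮C (subst (_< C) at-zero lt)))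
    (rest r λ i → +-monoʳ-≤ r (m≤n+m _ _))

count-early : {P : Fin n → Set} (P? : ∀ i → Dec (P i)) (C : ℕ) →
              count (λ i → P? i ×-dec (#before P? i <? C)) ≤ C
count-early P? C = count-early-from P? C 0

-- Partitions without large holes

bit : Dec A → Fin 2
bit (yes _) = suc zero
bit (no _)  = zero

bit-≡ : (a? : Dec A) (b? : Dec B) → bit a? ≡ bit b? → A → B
bit-≡ a?      (yes b) _  _ = b
bit-≡ (no ¬a) (no _)  _  a = contradiction a ¬a

-- A class is split for all its `k` cells at once, with one membership bit per cell; hence the
-- factor `2 ^ k`.
refine : (c : Fin m → Fin k) (P : Fin k → Fin k → Subset m) → Fin m → Fin (k * 2 ^ k)
refine c P y = combine (c y) (Fin.funToFin λ e → bit (y ∈? P (c y) e))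

refine-colour : (c : Fin m → Fin k) (P : Fin k → Fin k → Subset m) →
                ∀ {y y′} → refine c P y ≡ refine c P y′ → c y ≡ c y′
refine-colour c P {y} {y′} eq = proj₁ (Fin.combine-injective (c y) _ (c y′) _ eq)

refine-∈ : (c : Fin m → Fin k) (P : Fin k → Fin k → Subset m) →
           ∀ {y y′} → refine c P y ≡ refine c P y′ → ∀ {e} → y ∈ P (c y) e → y′ ∈ P (c y′) e
refine-∈ c P {y} {y′} eq {e} = bit-≡ (y ∈? P (c y) e) (y′ ∈? P (c y′) e) (begin
  bit (y ∈? P (c y) e)                                      ≡⟨ Fin.finToFun-funToFin _ e ⟨
  Fin.finToFun (Fin.funToFin λ e → bit (y ∈? P (c y) e)) e  ≡⟨ cong (λ h → Fin.finToFun h e) (proj₂ (Fin.combine-injective (c y) _ (c y′) _ eq)) ⟩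
  Fin.finToFun (Fin.funToFin λ e → bit (y′ ∈? P (c y′) e)) e ≡⟨ Fin.finToFun-funToFin _ e ⟩
  bit (y′ ∈? P (c y′) e)                                    ∎)
  where open ≡-Reasoning

size : (c : Fin m → Fin k) → Fin k → ℕ
size c b = count λ y → c y ≟ b

-- Summing the iterates of `k * 2 ^ k`, instead of taking the last one, bounds the number of classes
-- in whichever round `regularise` stops.
towerSum : ℕ → ℕ → ℕ
towerSum zero    k = k
towerSum (suc f) k = k + towerSum f (k * 2 ^ k)

k≤towerSum : ∀ f k → k ≤ towerSum f k
k≤towerSum zero    k = ≤-refl
k≤towerSum (suc f) k = m≤m+n k _

module Holes {m n : ℕ} {E : Fin m → Fin n → Set} (E? : ∀ y z → Dec (E y z)) (q : ℕ) .{{_ : NonZero q}} where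

  module _ {k} (c : Fin m → Fin k) (d : Fin n → Fin k) where

    Empty : Fin k → Fin k → Set
    Empty b e = ∀ y z → c y ≡ b → d z ≡ e → ¬ E y z

    -- Only the parts of `P` and `Q` inside the cell matter. Taking them as `Subset`s lets
    -- `anySubset?` search through all candidates.
    record Hole (b e : Fin k) (P : Subset m) (Q : Subset n) : Set where
      constructor hole
      field
        largeˡ : size c b ≤ q * count (λ y → (c y ≟ b) ×-dec (y ∈? P))
        largeʳ : size d e ≤ q * count (λ z → (d z ≟ e) ×-dec (z ∈? Q))
        noEdge : ∀ y z → (c y ≡ b × y ∈ P) → (d z ≡ e × z ∈ Q) → ¬ E y z

    HasHole : Fin k → Fin k → Set
    HasHole b e = ∃₂ (Hole b e)

    -- An edgeless cell is a hole in itself, but splitting it would gain no edgeless area, so it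
    -- does not count as bad.
    Bad : Fin k → Fin k → Set
    Bad b e = HasHole b e × ¬ Empty b e

    empty? : ∀ b e → Dec (Empty b e)
    empty? b e = all? λ y → all? λ z → (c y ≟ b) →-dec ((d z ≟ e) →-dec (¬? (E? y z)))

    hole? : ∀ b e P Q → Dec (Hole b e P Q)
    hole? b e P Q = map′ (λ (l , r , ¬E) → hole l r λ y z → ¬E y z) (λ (hole l r ¬E) → l , r , λ y z → ¬E y z)
      ((_ ≤? _) ×-dec (_ ≤? _) ×-dec (all? λ y → all? λ z →
        ((c y ≟ b) ×-dec (y ∈? P)) →-dec (((d z ≟ e) ×-dec (z ∈? Q)) →-dec (¬? (E? y z)))))

    hasHole? : ∀ b e → Dec (HasHole b e)
    hasHole? b e = anySubset? λ P → anySubset? λ Q → hole? b e P Q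

    bad? : ∀ b e → Dec (Bad b e)
    bad? b e = hasHole? b e ×-dec (¬? (empty? b e))

    emptyArea badArea : ℕ
    emptyArea = ∑[ y < m ] ∑[ z < n ] ⟦ empty? (c y) (d z) ⟧
    badArea   = ∑[ y < m ] ∑[ z < n ] ⟦ bad? (c y) (d z) ⟧

    badArea+emptyArea≤ : badArea + emptyArea ≤ m * n
    badArea+emptyArea≤ = begin
      badArea + emptyArea
        ≡⟨ ∑-distrib-+ (λ y → ∑[ z < n ] ⟦ bad? (c y) (d z) ⟧) (λ y → ∑[ z < n ] ⟦ empty? (c y) (d z) ⟧) ⟨
      ∑[ y < m ] (∑[ z < n ] ⟦ bad? (c y) (d z) ⟧ + ∑[ z < n ] ⟦ empty? (c y) (d z) ⟧)
        ≡⟨ sum-cong-≗ (λ y → sym (∑-distrib-+ (λ z → ⟦ bad? (c y) (d z) ⟧) (λ z → ⟦ empty? (c y) (d z) ⟧))) ⟩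
      ∑[ y < m ] ∑[ z < n ] (⟦ bad? (c y) (d z) ⟧ + ⟦ empty? (c y) (d z) ⟧)
        ≤⟨ ∑-mono (λ y → ∑-mono λ z → disjoint (c y) (d z)) ⟩
      ∑[ y < m ] ∑[ z < n ] 1
        ≡⟨ trans (sum-cong-≗ {m} λ _ → trans (∑-const n 1) (*-identityʳ n)) (∑-const m n) ⟩
      m * n ∎
      where
      open ≤-Reasoning
      disjoint : ∀ b e → ⟦ bad? b e ⟧ + ⟦ empty? b e ⟧ ≤ 1
      disjoint b e = case empty? b e of λ where
        (yes empty) → +-mono-≤ (≤-reflexive (⟦⟧-no (bad? b e) λ (_ , ¬empty) → ¬empty empty)) (⟦⟧≤1 (empty? b e))
        (no ¬empty) → subst (λ w → ⟦ bad? b e ⟧ + w ≤ 1) (sym (⟦⟧-no (empty? b e) ¬empty))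
                        (subst (_≤ 1) (sym (+-identityʳ _)) (⟦⟧≤1 (bad? b e)))

    -- `holeˡ` and `holeʳ` read off the same search result, so the two sides are split along the
    -- same hole. The default `⊥` gives every vertex the same bit and splits nothing.
    holeˡ : Fin k → Fin k → Subset m
    holeˡ b e with hasHole? b e
    ... | yes (P , _) = P
    ... | no _        = ⊥

    holeʳ : Fin k → Fin k → Subset n
    holeʳ b e with hasHole? b e
    ... | yes (_ , Q , _) = Q
    ... | no _            = ⊥

    chosenHole : ∀ {b e} → HasHole b e → Hole b e (holeˡ b e) (holeʳ b e)
    chosenHole {b} {e} h with hasHole? b e
    ... | yes (_ , _ , h′) = h′
    ... | no ¬h            = contradiction h ¬h

    c′ : Fin m → Fin (k * 2 ^ k)
    c′ = refine c holeˡ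

    d′ : Fin n → Fin (k * 2 ^ k)
    d′ = refine d λ e b → holeʳ b e

    inHole : Fin k → Fin k → Fin m → Fin n → ℕ
    inHole b e y z = ⟦ bad? b e ⟧ * (⟦ y ∈? holeˡ b e ⟧ * ⟦ z ∈? holeʳ b e ⟧)

    holeArea : ℕ
    holeArea = ∑[ y < m ] ∑[ z < n ] inHole (c y) (d z) y z

    -- In a bad cell the chosen hole takes up at least a fraction `1/q` of each side, hence `1/q²`
    -- of the area; the other cells contribute 0 to `badArea`.
    badArea≤holeArea : badArea ≤ q * q * holeArea
    badArea≤holeArea = begin
      badArea
        ≡⟨ ∑-fibres₂ c d (λ b e _ _ → ⟦ bad? b e ⟧) ⟩
      ∑[ b < k ] ∑[ e < k ] ∑[ y < m ] ∑[ z < n ] (⟦ c y ≟ b ⟧ * (⟦ d z ≟ e ⟧ * ⟦ bad? b e ⟧))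
        ≤⟨ ∑-mono (λ b → ∑-mono λ e → cell b e (bad? b e)) ⟩
      ∑[ b < k ] ∑[ e < k ] (q * q * cellHole b e)
        ≡⟨ sum-cong-≗ (λ b → sym (*-distribˡ-sum (q * q) (cellHole b))) ⟩
      ∑[ b < k ] (q * q * ∑[ e < k ] cellHole b e)
        ≡⟨ *-distribˡ-sum (q * q) (λ b → ∑[ e < k ] cellHole b e) ⟨
      q * q * ∑[ b < k ] ∑[ e < k ] cellHole b e
        ≡⟨ cong (q * q *_) (∑-fibres₂ c d inHole) ⟨
      q * q * holeArea ∎
      where
      open ≤-Reasoning
      cellHole : Fin k → Fin k → ℕ
      cellHole b e = ∑[ y < m ] ∑[ z < n ] (⟦ c y ≟ b ⟧ * (⟦ d z ≟ e ⟧ * inHole b e y z))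
      product : ∀ u {f : Fin m → Fin n → ℕ} (g : Fin m → ℕ) (h : Fin n → ℕ) →
                (∀ y z → f y z ≡ u * (g y * h z)) →
                ∑[ y < m ] ∑[ z < n ] f y z ≡ u * (∑[ y < m ] g y * ∑[ z < n ] h z)
      product u {f} g h f≡ = begin-equality
        ∑[ y < m ] ∑[ z < n ] f y z                  ≡⟨ sum-cong-≗ (λ y → sum-cong-≗ λ z → trans (f≡ y z) (sym (*-assoc u _ _))) ⟩
        ∑[ y < m ] ∑[ z < n ] (u * g y * h z)        ≡⟨ ∑-product (λ y → u * g y) h ⟩
        ∑[ y < m ] (u * g y) * ∑[ z < n ] h z        ≡⟨ cong (_* ∑[ z < n ] h z) (*-distribˡ-sum u g) ⟨
        u * ∑[ y < m ] g y * ∑[ z < n ] h z          ≡⟨ *-assoc u _ _ ⟩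
        u * (∑[ y < m ] g y * ∑[ z < n ] h z)        ∎
      cell : ∀ b e → Dec (Bad b e) →
             ∑[ y < m ] ∑[ z < n ] (⟦ c y ≟ b ⟧ * (⟦ d z ≟ e ⟧ * ⟦ bad? b e ⟧)) ≤ q * q * cellHole b e
      cell b e (no ¬bad) = ≤-trans (≤-reflexive (∑-zero {m} λ y → ∑-zero {n} λ z →
          trans (cong (λ w → ⟦ c y ≟ b ⟧ * (⟦ d z ≟ e ⟧ * w)) (⟦⟧-no (bad? b e) ¬bad))
            (trans (cong (⟦ c y ≟ b ⟧ *_) (*-zeroʳ ⟦ d z ≟ e ⟧)) (*-zeroʳ ⟦ c y ≟ b ⟧)))) z≤n
      cell b e (yes bad@(h , _)) = begin
        ∑[ y < m ] ∑[ z < n ] (⟦ c y ≟ b ⟧ * (⟦ d z ≟ e ⟧ * ⟦ bad? b e ⟧))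
          ≡⟨ product β (λ y → ⟦ c y ≟ b ⟧) (λ z → ⟦ d z ≟ e ⟧) (λ y z → rearrange ⟦ c y ≟ b ⟧ ⟦ d z ≟ e ⟧ β) ⟩
        β * (size c b * size d e)
          ≤⟨ *-monoʳ-≤ β (*-mono-≤ (Hole.largeˡ (chosenHole h)) (Hole.largeʳ (chosenHole h))) ⟩
        β * ((q * countˡ) * (q * countʳ))
          ≡⟨ pull-q q β countˡ countʳ ⟩
        q * q * (β * (countˡ * countʳ))
          ≡⟨ cong (q * q *_) (product β (λ y → ⟦ inˡ y ⟧) (λ z → ⟦ inʳ z ⟧) split) ⟨
        q * q * cellHole b e ∎
        where
        β = ⟦ bad? b e ⟧
        inˡ = λ y → (c y ≟ b) ×-dec (y ∈? holeˡ b e)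
        inʳ = λ z → (d z ≟ e) ×-dec (z ∈? holeʳ b e)
        countˡ = count inˡ
        countʳ = count inʳ
        rearrange : ∀ s t u → s * (t * u) ≡ u * (s * t)
        rearrange = solve-∀
        pull-q : ∀ q u s t → u * ((q * s) * (q * t)) ≡ q * q * (u * (s * t))
        pull-q = solve-∀
        regroup : ∀ s t u v w → s * (t * (u * (v * w))) ≡ u * ((s * v) * (t * w))
        regroup = solve-∀
        split : ∀ y z → ⟦ c y ≟ b ⟧ * (⟦ d z ≟ e ⟧ * inHole b e y z) ≡ β * (⟦ inˡ y ⟧ * ⟦ inʳ z ⟧)
        split y z = trans (regroup ⟦ c y ≟ b ⟧ ⟦ d z ≟ e ⟧ β ⟦ y ∈? holeˡ b e ⟧ ⟦ z ∈? holeʳ b e ⟧)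
          (sym (cong (β *_) (cong₂ _*_ (⟦⟧-× (c y ≟ b) (y ∈? holeˡ b e)) (⟦⟧-× (d z ≟ e) (z ∈? holeʳ b e)))))

  -- Classes only shrink, so a pair in an edgeless cell stays in one. A pair inside the chosen hole
  -- of a bad cell moves to a cell contained in that hole, which is edgeless too. Nothing is counted
  -- twice, since a bad cell is not edgeless.
  emptyArea-refine : ∀ {k} (c : Fin m → Fin k) (d : Fin n → Fin k) →
                     emptyArea c d + holeArea c d ≤ emptyArea (c′ c d) (d′ c d)
  emptyArea-refine {k} c d = begin
    emptyArea c d + holeArea c d
      ≡⟨ ∑-distrib-+ (λ y → ∑[ z < n ] ε y z) (λ y → ∑[ z < n ] η y z) ⟨
    ∑[ y < m ] (∑[ z < n ] ε y z + ∑[ z < n ] η y z)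
      ≡⟨ sum-cong-≗ (λ y → sym (∑-distrib-+ (ε y) (η y))) ⟩
    ∑[ y < m ] ∑[ z < n ] (ε y z + η y z)
      ≤⟨ ∑-mono (λ y → ∑-mono λ z → pointwise y z (empty? c d (c y) (d z)) (bad? c d (c y) (d z))
            (y ∈? holeˡ c d (c y) (d z)) (z ∈? holeʳ c d (c y) (d z))) ⟩
    emptyArea (c′ c d) (d′ c d) ∎
    where
    open ≤-Reasoning
    ε η ε′ : Fin m → Fin n → ℕ
    ε y z = ⟦ empty? c d (c y) (d z) ⟧
    η y z = inHole c d (c y) (d z) y z
    empty′? : ∀ y z → Dec (Empty (c′ c d) (d′ c d) (c′ c d y) (d′ c d z))
    empty′? y z = empty? (c′ c d) (d′ c d) (c′ c d y) (d′ c d z)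
    ε′ y z = ⟦ empty′? y z ⟧
    pointwise : ∀ y z (s : Dec (Empty c d (c y) (d z))) (t : Dec (Bad c d (c y) (d z)))
                (u : Dec (y ∈ holeˡ c d (c y) (d z))) (v : Dec (z ∈ holeʳ c d (c y) (d z))) →
                ⟦ s ⟧ + ⟦ t ⟧ * (⟦ u ⟧ * ⟦ v ⟧) ≤ ε′ y z
    pointwise y z (yes empty) (yes (_ , ¬empty)) u v = contradiction empty ¬empty
    pointwise y z (yes empty) (no _) u v = ≤-reflexive (sym (⟦⟧-yes (empty′? y z) λ y₁ z₁ cy dz →
      empty y₁ z₁ (refine-colour c (holeˡ c d) cy) (refine-colour d (λ e b → holeʳ c d b e) dz)))
    pointwise y z (no _) (no _) u v = z≤n
    pointwise y z (no _) (yes _) (no _) v = z≤n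
    pointwise y z (no _) (yes _) (yes _) (no _) = z≤n
    pointwise y z (no _) (yes (h , _)) (yes y∈P) (yes z∈Q) = ≤-reflexive (sym (⟦⟧-yes (empty′? y z) noEdge′))
      where
      noEdge′ : Empty (c′ c d) (d′ c d) (c′ c d y) (d′ c d z)
      noEdge′ y₁ z₁ cy dz = Hole.noEdge (chosenHole c d h) y₁ z₁
        (cy₁ , subst (λ b → y₁ ∈ holeˡ c d b (d z)) cy₁ (refine-∈ c (holeˡ c d) (sym cy) y∈P))
        (dz₁ , subst (λ e → z₁ ∈ holeʳ c d (c y) e) dz₁ (refine-∈ d (λ e b → holeʳ c d b e) (sym dz) z∈Q))
        where
        cy₁ = refine-colour c (holeˡ c d) cy
        dz₁ = refine-colour d (λ e b → holeʳ c d b e) dz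

  -- The number `f` of remaining rounds is tied to progress: the area outside edgeless cells is at
  -- most `f/q³` of `m * n`. A round gains at least `m * n / q³` and so pays for lowering `f` by
  -- one.
  regularise : ∀ f {k} (c : Fin m → Fin k) (d : Fin n → Fin k) →
               q * (q * q) * (m * n) ≤ q * (q * q) * emptyArea c d + f * (m * n) →
               ∃[ k′ ] Σ[ c* ∈ (Fin m → Fin k′) ] Σ[ d* ∈ (Fin n → Fin k′) ]
                 (k′ ≤ towerSum f k × q * badArea c* d* ≤ m * n)
  regularise f {k} c d progress with q * badArea c d ≤? m * n
  ... | yes few = k , c , d , k≤towerSum f k , few
  regularise zero {k} c d progress | no many = contradiction few many
    where
    open ≤-Reasoning
    instance
      q³≢0 : NonZero (q * (q * q))
      q³≢0 = m*n≢0 q (q * q) {{it}} {{m*n≢0 q q}}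
    -- With no rounds left the edgeless cells fill everything, which leaves no bad area and
    -- contradicts `many`.
    all-empty : m * n ≤ emptyArea c d
    all-empty = *-cancelˡ-≤ (q * (q * q)) (≤-trans progress (≤-reflexive (+-identityʳ _)))
    few : q * badArea c d ≤ m * n
    few = begin
      q * badArea c d ≡⟨ cong (q *_) (n≤0⇒n≡0 (+-cancelʳ-≤ (emptyArea c d) _ 0 (≤-trans (badArea+emptyArea≤ c d) all-empty))) ⟩
      q * 0           ≡⟨ *-zeroʳ q ⟩
      0               ≤⟨ z≤n ⟩
      m * n           ∎
  regularise (suc f) {k} c d progress | no many =
    let k′ , c* , d* , k′≤ , few = regularise f (c′ c d) (d′ c d) progress′
    in k′ , c* , d* , ≤-trans k′≤ (m≤n+m _ k) , few
    where
    open ≤-Reasoning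
    -- A round is run only when the bad area is at least `m * n / q`, and the chosen holes fill at
    -- least `1/q²` of it.
    gain : m * n ≤ q * (q * q * holeArea c d)
    gain = ≤-trans (≰⇒≥ many) (*-monoʳ-≤ q (badArea≤holeArea c d))
    progress′ : q * (q * q) * (m * n) ≤ q * (q * q) * emptyArea (c′ c d) (d′ c d) + f * (m * n)
    progress′ = begin
      q * (q * q) * (m * n)                                                 ≤⟨ progress ⟩
      q * (q * q) * emptyArea c d + (m * n + f * (m * n))                   ≡⟨ +-assoc (q * (q * q) * emptyArea c d) _ _ ⟨
      q * (q * q) * emptyArea c d + m * n + f * (m * n)                     ≤⟨ +-monoˡ-≤ (f * (m * n)) (+-monoʳ-≤ (q * (q * q) * emptyArea c d) gain) ⟩
      q * (q * q) * emptyArea c d + q * (q * q * holeArea c d) + f * (m * n) ≡⟨ cong (_+ f * (m * n)) (factor q (emptyArea c d) (holeArea c d)) ⟩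
      q * (q * q) * (emptyArea c d + holeArea c d) + f * (m * n)            ≤⟨ +-monoˡ-≤ _ (*-monoʳ-≤ (q * (q * q)) (emptyArea-refine c d)) ⟩
      q * (q * q) * emptyArea (c′ c d) (d′ c d) + f * (m * n)               ∎
      where
      factor : ∀ q u v → q * (q * q) * u + q * (q * q * v) ≡ q * (q * q) * (u + v)
      factor = solve-∀

-- Ordered matchings

module _ {P : Fin n → Set} (P? : ∀ i → Dec (P i)) where

  subset : Subset n
  subset = tabulate (does ∘ P?)

  ∈-subset⁺ : ∀ {i} → P i → i ∈ subset
  ∈-subset⁺ {i} p = lookup⇒[]= i subset (trans (lookup∘tabulate _ i) (dec-true (P? i) p))

  ∈-subset⁻ : ∀ {i} → i ∈ subset → P i
  ∈-subset⁻ {i} i∈ with P? i | trans (sym (lookup∘tabulate (does ∘ P?) i)) ([]=⇒lookup i∈)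
  ... | yes p | _ = p
  ... | no _  | ()

∑-size : (c : Fin m → Fin k) → ∑[ b < k ] size c b ≡ m
∑-size {m} {k} c = begin
  ∑[ b < k ] size c b                           ≡⟨ sum-cong-≗ (λ b → sum-cong-≗ λ i → sym (*-identityʳ ⟦ c i ≟ b ⟧)) ⟩
  ∑[ b < k ] ∑[ i < m ] (⟦ c i ≟ b ⟧ * 1)       ≡⟨ ∑-fibres c (λ _ _ → 1) ⟨
  ∑[ i < m ] 1                                  ≡⟨ ∑-const m 1 ⟩
  m * 1                                         ≡⟨ *-identityʳ m ⟩
  m                                             ∎
  where open ≡-Reasoning

module _ (q : ℕ) .{{_ : NonZero q}} where

  -- Adding one to the rounded-down quotient makes `q` quotas cover the class; the extra ones add up
  -- to the term `k * q` in `∑-quota`.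
  quota : ℕ → ℕ
  quota s = suc (s / q)

  s≤q*quota : ∀ s → s ≤ q * quota s
  s≤q*quota s = begin
    s                    ≡⟨ m≡m%n+[m/n]*n s q ⟩
    s % q + s / q * q    ≤⟨ +-monoˡ-≤ _ (m%n≤n s q) ⟩
    q + s / q * q        ≡⟨ *-comm (quota s) q ⟩
    q * quota s          ∎
    where open ≤-Reasoning

  ∑-quota : (c : Fin m → Fin k) → q * ∑[ b < k ] quota (size c b) ≤ k * q + m
  ∑-quota {m} {k} c = begin
    q * ∑[ b < k ] quota (size c b)          ≡⟨ *-distribˡ-sum q (λ b → quota (size c b)) ⟩
    ∑[ b < k ] (q * quota (size c b))        ≤⟨ ∑-mono (λ b → ≤-trans (≤-reflexive (*-comm q (quota (size c b)))) (+-monoʳ-≤ q (m/n*n≤m (size c b) q))) ⟩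
    ∑[ b < k ] (q + size c b)                ≡⟨ ∑-distrib-+ (λ _ → q) (size c) ⟩
    ∑[ b < k ] q + ∑[ b < k ] size c b       ≡⟨ cong₂ _+_ (∑-const k q) (∑-size c) ⟩
    k * q + m                                ∎
    where open ≤-Reasoning

  module _ (c : Fin m → Fin k) {n : ℕ} (φ : Fin n → Fin m) where

    sameClass? : ∀ b i → Dec (c (φ i) ≡ b)
    sameClass? b i = c (φ i) ≟ b

    isLast? : ∀ i → Dec (#after (sameClass? (c (φ i))) i < quota (size c (c (φ i))))
    isLast? i = _ <? _

    isFirst? : ∀ i → Dec (#before (sameClass? (c (φ i))) i < quota (size c (c (φ i))))
    isFirst? i = _ <? _

    count-last : count isLast? ≤ ∑[ b < k ] quota (size c b)
    count-last = begin
      count isLast?                                    ≡⟨ ∑-fibres (c ∘ φ) (λ b i → ⟦ last? b i ⟧) ⟩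
      ∑[ b < k ] ∑[ i < n ] (⟦ sameClass? b i ⟧ * ⟦ last? b i ⟧) ≡⟨ sum-cong-≗ (λ b → sum-cong-≗ λ i → sym (⟦⟧-× (sameClass? b i) (last? b i))) ⟩
      ∑[ b < k ] count (λ i → sameClass? b i ×-dec last? b i) ≤⟨ ∑-mono (λ b → count-late (sameClass? b) (quota (size c b))) ⟩
      ∑[ b < k ] quota (size c b)                      ∎
      where
      open ≤-Reasoning
      last? : ∀ b i → Dec (#after (sameClass? b) i < quota (size c b))
      last? b i = _ <? _

    count-first : count isFirst? ≤ ∑[ b < k ] quota (size c b)
    count-first = begin
      count isFirst?                                   ≡⟨ ∑-fibres (c ∘ φ) (λ b i → ⟦ first? b i ⟧) ⟩
      ∑[ b < k ] ∑[ i < n ] (⟦ sameClass? b i ⟧ * ⟦ first? b i ⟧) ≡⟨ sum-cong-≗ (λ b → sum-cong-≗ λ i → sym (⟦⟧-× (sameClass? b i) (first? b i))) ⟩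
      ∑[ b < k ] count (λ i → sameClass? b i ×-dec first? b i) ≤⟨ ∑-mono (λ b → count-early (sameClass? b) (quota (size c b))) ⟩
      ∑[ b < k ] quota (size c b)                      ∎
      where
      open ≤-Reasoning
      first? : ∀ b i → Dec (#before (sameClass? b) i < quota (size c b))
      first? b i = _ <? _

    -- By injectivity of `φ`, a quota of indices landing in the class yields as many distinct
    -- vertices of `U` in it, enough for one side of a `Hole`.
    large : (∀ {i j} → φ i ≡ φ j → i ≡ j) → ∀ {b} {P : Fin n → Set} (P? : ∀ j → Dec (P j)) →
            quota (size c b) ≤ count (λ j → P? j ×-dec sameClass? b j) → ∀ (U : Subset m) → (∀ {j} → P j → φ j ∈ U) →
            size c b ≤ q * count (λ u → (c u ≟ b) ×-dec (u ∈? U))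
    large inj {b} P? many U P⇒U = begin
      size c b                                                   ≤⟨ s≤q*quota (size c b) ⟩
      q * quota (size c b)                                       ≤⟨ *-monoʳ-≤ q many ⟩
      q * count (λ j → P? j ×-dec sameClass? b j)                ≤⟨ *-monoʳ-≤ q (∑-mono λ j →
          ⟦⟧-mono (P? j ×-dec sameClass? b j) (inU? (φ j)) λ (p , s) → s , P⇒U p) ⟩
      q * ∑[ j < n ] ⟦ inU? (φ j) ⟧                              ≤⟨ *-monoʳ-≤ q (∑-injective inj λ u → ⟦ inU? u ⟧) ⟩
      q * count inU?                                             ∎
      where
      open ≤-Reasoning
      inU? : ∀ u → Dec (c u ≡ b × u ∈ U)
      inU? u = (c u ≟ b) ×-dec (u ∈? U)

-- For each `x` the edges `(y x i , z x i)` form a matching, and the `a` matchings are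
-- edge-disjoint. Were `ordered` to exclude all `i ≢ j`, the matchings would be induced, as in the
-- Ruzsa-Szemerédi theorem; here only one order of the indices is excluded.
module OrderedMatchings {a n N : ℕ} (y z : Fin a → Fin n → Fin N)
  (y-injective : ∀ x {i j} → y x i ≡ y x j → i ≡ j)
  (z-injective : ∀ x {i j} → z x i ≡ z x j → i ≡ j)
  (yz-injective : ∀ {x i x′ i′} → y x i ≡ y x′ i′ → z x i ≡ z x′ i′ → x ≡ x′ × i ≡ i′)
  (ordered : ∀ {x i j x′ l} → y x′ l ≡ y x j → z x′ l ≡ z x i → ¬ (i Fin.< j))
  where

  Edge : Fin N → Fin N → Set
  Edge u v = ∃₂ λ x i → y x i ≡ u × z x i ≡ v

  edge? : ∀ u v → Dec (Edge u v)
  edge? u v = any? λ x → any? λ i → (y x i ≟ u) ×-dec (z x i ≟ v)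

  module _ (q : ℕ) .{{_ : NonZero q}} where
    open Holes edge? q

    -- If `i` is neither last nor first, the `y x j` with `j` after `i` and the `z x j′` with `j′`
    -- before `i` fill a quota on each side of the cell. An edge between them would violate
    -- `ordered`, so they form a hole; the cell is bad since it contains the edge of `(x , i)`.
    classify : ∀ {k} (c d : Fin N → Fin k) x i →
      1 ≤ ⟦ bad? c d (c (y x i)) (d (z x i)) ⟧ + (⟦ isLast? q c (y x) i ⟧ + ⟦ isFirst? q d (z x) i ⟧)
    classify c d x i = cases (isLast? q c (y x) i) (isFirst? q d (z x) i)
      where
      after? : ∀ u → Dec (∃ λ j → i Fin.< j × y x j ≡ u)
      after? u = any? λ j → (i Fin.<? j) ×-dec (y x j ≟ u)
      before? : ∀ v → Dec (∃ λ j → j Fin.< i × z x j ≡ v)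
      before? v = any? λ j → (j Fin.<? i) ×-dec (z x j ≟ v)
      noEdge : ∀ u v → ∃ (λ j → i Fin.< j × y x j ≡ u) → ∃ (λ j → j Fin.< i × z x j ≡ v) → ¬ Edge u v
      noEdge u v (j , i<j , yj≡u) (j′ , j′<i , zj′≡v) (x′ , l , yl≡u , zl≡v) =
        ordered {x} {j′} {j} (trans yl≡u (sym yj≡u)) (trans zl≡v (sym zj′≡v)) (<-trans j′<i i<j)
      bad : quota q (size c (c (y x i))) ≤ #after (sameClass? q c (y x) (c (y x i))) i →
            quota q (size d (d (z x i))) ≤ #before (sameClass? q d (z x) (d (z x i))) i →
            Bad c d (c (y x i)) (d (z x i))
      bad l f =
        ( subset after? , subset before?
        , hole (large q c (y x) (y-injective x) (λ j → i Fin.<? j) l (subset after?) λ i<j → ∈-subset⁺ after? (_ , i<j , refl))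
               (large q d (z x) (z-injective x) (λ j → j Fin.<? i) f (subset before?) λ j<i → ∈-subset⁺ before? (_ , j<i , refl))
               λ u v (_ , u∈) (_ , v∈) → noEdge u v (∈-subset⁻ after? u∈) (∈-subset⁻ before? v∈))
        , λ empty → empty (y x i) (z x i) refl refl (x , i , refl , refl)

      cases : (s : Dec (#after (sameClass? q c (y x) (c (y x i))) i < quota q (size c (c (y x i)))))
              (t : Dec (#before (sameClass? q d (z x) (d (z x i))) i < quota q (size d (d (z x i))))) →
              1 ≤ ⟦ bad? c d (c (y x i)) (d (z x i)) ⟧ + (⟦ s ⟧ + ⟦ t ⟧)
      cases (yes _) t       = ≤-trans (m≤m+n 1 ⟦ t ⟧) (m≤n+m _ _)
      cases (no _)  (yes _) = m≤n+m 1 _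
      cases (no ¬l) (no ¬f) = ≤-trans
        (≤-reflexive (sym (⟦⟧-yes (bad? c d (c (y x i)) (d (z x i))) (bad (≮⇒≥ ¬l) (≮⇒≥ ¬f))))) (m≤m+n _ 0)

    -- Each edge is charged to a bad cell or to a last or first index. The bad area pays for the
    -- former; for each `x` the quotas of both sides pay for the latter.
    count-bound : q * (a * n) ≤ N * N + a * (2 * (towerSum (q * (q * q)) 1 * q + N))
    count-bound =
      -- Starting from one class on each side with `q³` rounds, the progress condition holds
      -- trivially.
      let k , c , d , k≤ , few = regularise (q * (q * q)) {1} (λ _ → zero) (λ _ → zero) (m≤n+m _ _)
      in bound c d k≤ few
      where
      open ≤-Reasoning
      bound : ∀ {k} (c d : Fin N → Fin k) → k ≤ towerSum (q * (q * q)) 1 → q * badArea c d ≤ N * N →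
              q * (a * n) ≤ N * N + a * (2 * (towerSum (q * (q * q)) 1 * q + N))
      bound {k} c d k≤ few = begin
        q * (a * n)
          ≡⟨ cong (q *_) (sym (trans (sum-cong-≗ {a} λ _ → trans (∑-const n 1) (*-identityʳ n)) (∑-const a n))) ⟩
        q * ∑[ x < a ] ∑[ i < n ] 1
          ≤⟨ *-monoʳ-≤ q (∑-mono λ x → ∑-mono λ i → classify c d x i) ⟩
        q * ∑[ x < a ] ∑[ i < n ] (β x i + (λ′ x i + φ x i))
          ≡⟨ cong (q *_) (sum-cong-≗ λ x → trans (∑-distrib-+ (β x) _) (cong (∑[ i < n ] β x i +_) (∑-distrib-+ (λ′ x) (φ x)))) ⟩
        q * ∑[ x < a ] (∑[ i < n ] β x i + (∑[ i < n ] λ′ x i + ∑[ i < n ] φ x i))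
          ≤⟨ *-monoʳ-≤ q (∑-mono λ x → +-monoʳ-≤ (∑[ i < n ] β x i) (+-mono-≤ (count-last q c (y x)) (count-first q d (z x)))) ⟩
        q * ∑[ x < a ] (∑[ i < n ] β x i + (Lc + Ld))
          ≡⟨ cong (q *_) (trans (∑-distrib-+ (λ x → ∑[ i < n ] β x i) _) (cong (∑[ x < a ] ∑[ i < n ] β x i +_) (∑-const a (Lc + Ld)))) ⟩
        q * (∑[ x < a ] ∑[ i < n ] β x i + a * (Lc + Ld))
          -- Distinct `(x , i)` give distinct pairs of vertices, so the edges in bad cells number at
          -- most the bad area.
          ≤⟨ *-monoʳ-≤ q (+-monoˡ-≤ (a * (Lc + Ld)) (∑-injective₂ yz-injective λ u v → ⟦ bad? c d (c u) (d v) ⟧)) ⟩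
        q * (badArea c d + a * (Lc + Ld))
          ≡⟨ distribute q (badArea c d) a Lc Ld ⟩
        q * badArea c d + a * (q * Lc + q * Ld)
          ≤⟨ +-mono-≤ few (*-monoʳ-≤ a (+-mono-≤ (cost c) (cost d))) ⟩
        N * N + a * (K + K)
          ≡⟨ cong (λ w → N * N + a * (K + w)) (+-identityʳ K) ⟨
        N * N + a * (2 * K) ∎
        where
        K Lc Ld : ℕ
        K = towerSum (q * (q * q)) 1 * q + N
        Lc = ∑[ b < k ] quota q (size c b)
        Ld = ∑[ b < k ] quota q (size d b)
        β λ′ φ : Fin a → Fin n → ℕ
        β x i = ⟦ bad? c d (c (y x i)) (d (z x i)) ⟧
        λ′ x i = ⟦ isLast? q c (y x) i ⟧
        φ x i = ⟦ isFirst? q d (z x) i ⟧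
        cost : ∀ (e : Fin N → Fin k) → q * ∑[ b < k ] quota q (size e b) ≤ K
        cost e = ≤-trans (∑-quota q e) (+-monoˡ-≤ N (*-monoˡ-≤ q k≤))
        distribute : ∀ q b a l m → q * (b + a * (l + m)) ≡ q * b + a * (q * l + q * m)
        distribute = solve-∀

threshold : ℕ → ℕ
threshold l = 2 * (towerSum (q * (q * q)) 1 * q) where q = 4 * suc l

module _ {a n N : ℕ} {y z : Fin a → Fin n → Fin N}
  (y-injective : ∀ x {i j} → y x i ≡ y x j → i ≡ j)
  (z-injective : ∀ x {i j} → z x i ≡ z x j → i ≡ j)
  (yz-injective : ∀ {x i x′ i′} → y x i ≡ y x′ i′ → z x i ≡ z x′ i′ → x ≡ x′ × i ≡ i′)
  (ordered : ∀ {x i j x′ l} → y x′ l ≡ y x j → z x′ l ≡ z x i → ¬ (i Fin.< j))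
  where

  -- The choice `q = 4 * suc l` leaves room for four copies of `N * N`: one for the bad area, two
  -- for the part of the quotas linear in `N`, and one for their constant part, which `threshold l`
  -- bounds.
  orderedMatchings-bound : a ≤ N → ∀ l → threshold l ≤ N → suc l * (a * n) ≤ N * N
  orderedMatchings-bound a≤N l large-N = *-cancelˡ-≤ 4 (begin
    4 * (suc l * (a * n))                       ≡⟨ *-assoc 4 (suc l) (a * n) ⟨
    q * (a * n)                                 ≤⟨ count-bound q ⟩
    N * N + a * (2 * (T + N))                   ≤⟨ +-monoʳ-≤ (N * N) (*-monoˡ-≤ _ a≤N) ⟩
    N * N + N * (2 * (T + N))                   ≡⟨ expand N T ⟩
    3 * (N * N) + N * (2 * T)                   ≤⟨ +-monoʳ-≤ (3 * (N * N)) (*-monoʳ-≤ N large-N) ⟩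
    3 * (N * N) + N * N                         ≡⟨ collect (N * N) ⟩
    4 * (N * N)                                 ∎)
    where
    open ≤-Reasoning
    open OrderedMatchings y z y-injective z-injective yz-injective ordered
    q T : ℕ
    q = 4 * suc l
    T = towerSum (q * (q * q)) 1 * q
    expand : ∀ N T → N * N + N * (2 * (T + N)) ≡ 3 * (N * N) + N * (2 * T)
    expand = solve-∀
    collect : ∀ s → 3 * s + s ≡ 4 * s
    collect = solve-∀

-- The rate ω

-- A downward search for a level whose threshold `N` has passed. The default 0 makes `ω` equal to 1,
-- where the bound is trivial.
level-from : ℕ → ℕ → ℕ
level-from N zero    = 0
level-from N (suc l) with threshold (suc l) ≤? N
... | yes _ = suc l
... | no _  = level-from N l

level : ℕ → ℕ
level N = level-from N N

level-from-valid : ∀ N l → level-from N l ≡ 0 ⊎ threshold (level-from N l) ≤ N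
level-from-valid N zero    = inj₁ refl
level-from-valid N (suc l) with threshold (suc l) ≤? N
... | yes θ≤N = inj₂ θ≤N
... | no _    = level-from-valid N l

-- The search descends from `m` and stops at the first valid level, so it cannot pass the valid
-- level `l`.
level-from-greatest : ∀ {N l} m → l ≤ m → threshold l ≤ N → l ≤ level-from N m
level-from-greatest zero l≤m θ≤N = l≤m
level-from-greatest {N} (suc m) l≤m θ≤N with threshold (suc m) ≤? N | m≤n⇒m<n∨m≡n l≤m
... | yes _ | _               = l≤m
... | no _  | inj₁ (s≤s l≤m′) = level-from-greatest m l≤m′ θ≤N
... | no ¬θ | inj₂ refl       = contradiction θ≤N ¬θ

ω : ℕ → ℚ
ω N = pos 1 ℚ./ suc (level N)

ω-nonneg : NonNeg ω
ω-nonneg N = ℚ.nonNegative⁻¹ (ω N) {{ℚ.normalize-nonNeg 1 (suc (level N))}}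

toℚᵘ-/ : ∀ i d → toℚᵘ (i ℚ./ suc d) ≃ mkℚᵘ i d
toℚᵘ-/ i d = ℚ.toℚᵘ-fromℚᵘ (mkℚᵘ i d)

ω-tends : TendsToZero ω
-- Here `ε` is `p / suc d` with `p` at least 1, so level `d` suffices. `N` must pass `threshold d`
-- and also `d` itself, because `level N` searches only up to `N`.
ω-tends ε@(mkℚ p d _) ε>0 = threshold d ⊔ d , λ N N≥ → ℚ.toℚᵘ-cancel-≤ (begin
  toℚᵘ (ω N)           ≃⟨ toℚᵘ-/ (pos 1) (level N) ⟩
  mkℚᵘ (pos 1) (level N) ≤⟨ *≤* (ℤ.≤-trans
    (ℤ.*-monoˡ-≤-nonNeg (pos 1) (+≤+ (s≤s (level-from-greatest N (m⊔n≤o⇒n≤o (threshold d) d N≥) (m⊔n≤o⇒m≤o (threshold d) d N≥)))))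
    (ℤ.*-monoʳ-≤-nonNeg (pos (suc (level N))) (positive ε>0))) ⟩
  toℚᵘ ε               ∎)
  where
  open ℚᵘ.≤-Reasoning
  positive : 0ℚ ℚ.< ε → pos 1 ℤ.≤ p
  positive (ℚ.*<* 0<p) = ℤ.i<j⇒suc[i]≤j (subst (pos 0 ℤ.<_) (ℤ.*-identityʳ p) 0<p)

ℚ-bound : ∀ n a l N → suc l * (a * n) ≤ N * N →
          ℕ→ℚ n ℚ.* ℕ→ℚ a ℚ.≤ (pos 1 ℚ./ suc l) ℚ.* (ℕ→ℚ N ℚ.* ℕ→ℚ N)
ℚ-bound n a l N le = ℚ.toℚᵘ-cancel-≤ (begin
  toℚᵘ (ℕ→ℚ n ℚ.* ℕ→ℚ a)                                        ≃⟨ product n a ⟩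
  mkℚᵘ (pos n ℤ.* pos a) 0                                          ≤⟨ *≤* (subst₂ ℤ._≤_ lhs rhs (+≤+ le)) ⟩
  mkℚᵘ (pos 1) l ℚᵘ.* mkℚᵘ (pos N ℤ.* pos N) 0                        ≃⟨ ℚᵘ.*-cong (toℚᵘ-/ (pos 1) l) (product N N) ⟨
  toℚᵘ (pos 1 ℚ./ suc l) ℚᵘ.* toℚᵘ (ℕ→ℚ N ℚ.* ℕ→ℚ N)              ≃⟨ ℚ.toℚᵘ-homo-* (pos 1 ℚ./ suc l) (ℕ→ℚ N ℚ.* ℕ→ℚ N) ⟨
  toℚᵘ ((pos 1 ℚ./ suc l) ℚ.* (ℕ→ℚ N ℚ.* ℕ→ℚ N))                  ∎)
  where
  open ℚᵘ.≤-Reasoning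
  product : ∀ m n → toℚᵘ (ℕ→ℚ m ℚ.* ℕ→ℚ n) ≃ mkℚᵘ (pos m ℤ.* pos n) 0
  product m n = ℚᵘ.≃-trans (ℚ.toℚᵘ-homo-* (ℕ→ℚ m) (ℕ→ℚ n)) (ℚᵘ.*-cong (toℚᵘ-/ (pos m) 0) (toℚᵘ-/ (pos n) 0))
  regroup : ∀ l a n → suc l * (a * n) ≡ n * a * (suc l * 1)
  regroup = solve-∀
  lhs : pos (suc l * (a * n)) ≡ (pos n ℤ.* pos a) ℤ.* pos (suc l * 1)
  lhs = trans (cong pos (regroup l a n)) (trans (ℤ.pos-* (n * a) (suc l * 1)) (cong (ℤ._* pos (suc l * 1)) (ℤ.pos-* n a)))
  rhs : pos (N * N) ≡ (pos 1 ℤ.* (pos N ℤ.* pos N)) ℤ.* pos 1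
  rhs = trans (ℤ.pos-* N N) (sym (trans (ℤ.*-identityʳ _) (ℤ.*-identityˡ _)))

-- The group-theoretic construction

module _ {a r} {A : Set a} {R : A → A → Set r} where

  AllPairs-lookup : ∀ {xs} → AllPairs R xs → ∀ {i j} → i Fin.< j → R (lookup xs i) (lookup xs j)
  AllPairs-lookup (rx ∷ _) {zero}  {suc j} _         = All.lookup rx (∈-lookup (≡.setoid A) _ j)
  AllPairs-lookup (_ ∷ rs) {suc i} {suc j} (s≤s i<j) = AllPairs-lookup rs i<j

  -- The tail is treated first and a kept `x` goes to the front, so `¬ R x y` says that a newcomer
  -- was not covered by an element kept earlier. The converse direction may fail, which is why the
  -- matchings are only ordered.
  greedy : (∀ x y → Dec (R x y)) → (∀ x → R x x) → (xs : List A) →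
           ∃[ ys ] AllPairs (λ x y → ¬ R x y) ys × All (λ x → Any (R x) ys) xs
  greedy R? R-refl []       = [] , [] , []
  greedy R? R-refl (x ∷ xs) with greedy R? R-refl xs
  ... | ys , pairs , covered with Any.any? (R? x) ys
  ...   | yes x-covered = ys , pairs , x-covered ∷ covered
  ...   | no ¬x-covered = x ∷ ys , ¬Any⇒All¬ ys ¬x-covered ∷ pairs , here (R-refl x) ∷ All.map there covered

module Cover {c ℓ : Level} (G : Group c ℓ) where
  open GroupSets G renaming (refl to ≈-refl; sym to ≈-sym; trans to ≈-trans)
  open GroupProperties G using (∙-cancelˡ; ∙-cancelʳ)

  ≉-injective : ∀ {n} (f : Fin n → Carrier) → (∀ {i j} → i Fin.< j → ¬ f i ≈ f j) → ∀ {i j} → f i ≈ f j → i ≡ j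
  ≉-injective f distinct {i} {j} eq with Fin.<-cmp i j
  ... | tri< i<j _ _ = contradiction eq (distinct i<j)
  ... | tri≈ _ i≡j _ = i≡j
  ... | tri> _ _ j<i = contradiction (≈-sym eq) (distinct j<i)

  nth : (A : FinSubset) → Fin ∣ A ∣ → Carrier
  nth A = lookup (elems A)

  nth-∈ : ∀ A i → nth A i ∈ₛ A
  nth-∈ A = ∈-lookup setoid (elems A)

  nth-injective : ∀ A {i j} → nth A i ≈ nth A j → i ≡ j
  nth-injective A = ≉-injective (nth A) (AllPairs-lookup (unique A))

  first : ∀ A → NonemptySet A → Fin ∣ A ∣
  first (finSubset []      _) ≢[] = contradiction refl ≢[]
  first (finSubset (_ ∷ _) _) _   = zero

  module Construction (S T X : FinSubset) (S≢∅ : NonemptySet S) (T≢∅ : NonemptySet T) (X≢∅ : NonemptySet X)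
                      (Z : FinSubset) (Z≡XST : IsSetOf Z (InProd3 X S T)) where

    s = nth S
    t = nth T
    x = nth X

    code-∈ : ∀ h i j → ((x h ∙ s i) ∙ t j) ∈ₛ Z
    code-∈ h i j = proj₂ (Z≡XST _) (x h , s i , t j , nth-∈ X h , nth-∈ S i , nth-∈ T j , ≈-refl)

    code : Fin ∣ X ∣ → Fin ∣ S ∣ → Fin ∣ T ∣ → Fin ∣ Z ∣
    code h i j = index (code-∈ h i j)

    nth-code : ∀ h i j → (x h ∙ s i) ∙ t j ≈ nth Z (code h i j)
    nth-code h i j = lookup-index (code-∈ h i j)

    code-reflects : ∀ {h i j h′ i′ j′} → code h i j ≡ code h′ i′ j′ → (x h ∙ s i) ∙ t j ≈ (x h′ ∙ s i′) ∙ t j′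
    code-reflects {h} {i} {j} {h′} {i′} {j′} eq =
      ≈-trans (nth-code h i j) (≈-trans (reflexive (cong (nth Z) eq)) (≈-sym (nth-code h′ i′ j′)))

    code-cong : ∀ {h i j h′ i′ j′} → (x h ∙ s i) ∙ t j ≈ (x h′ ∙ s i′) ∙ t j′ → code h i j ≡ code h′ i′ j′
    code-cong {h} {i} {j} {h′} {i′} {j′} eq =
      nth-injective Z (≈-trans (≈-sym (nth-code h i j)) (≈-trans eq (nth-code h′ i′ j′)))

    h₀ = first X X≢∅
    i₀ = first S S≢∅
    j₀ = first T T≢∅

    -- Equality in G need not be decidable, but multiplying by a fixed element of X turns equality
    -- of products in ST into equality of positions in Z.
    st≈? : ∀ i j i′ j′ → Dec (s i ∙ t j ≈ s i′ ∙ t j′)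
    st≈? i j i′ j′ = map′
      (λ eq → ∙-cancelˡ (x h₀) _ _ (≈-trans (≈-sym (assoc _ _ _)) (≈-trans (code-reflects eq) (assoc _ _ _))))
      (λ eq → code-cong (≈-trans (assoc _ _ _) (≈-trans (∙-congˡ eq) (≈-sym (assoc _ _ _)))))
      (code h₀ i j ≟ code h₀ i′ j′)

    Pair : Set
    Pair = Fin ∣ S ∣ × Fin ∣ T ∣

    -- Keeping `(i′ , j′)` puts all of `s i′ ∙ T` and `S ∙ t j′` into S′T ∪ ST′.
    Covers : Pair → Pair → Set ℓ
    Covers (i , j) (i′ , j′) = (∃ λ j₁ → s i ∙ t j ≈ s i′ ∙ t j₁) ⊎ (∃ λ i₁ → s i ∙ t j ≈ s i₁ ∙ t j′)

    covers? : ∀ p p′ → Dec (Covers p p′)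
    covers? (i , j) (i′ , j′) = (any? λ j₁ → st≈? i j i′ j₁) ⊎-dec (any? λ i₁ → st≈? i j i₁ j′)

    chain : ∃[ L ] AllPairs (λ p p′ → ¬ Covers p p′) L ×
                   All (λ p → Any (Covers p) L) (cartesianProduct (allFin ∣ S ∣) (allFin ∣ T ∣))
    chain = greedy covers? (λ (i , j) → inj₁ (j , ≈-refl)) _

    -- Position 0 of the list holds the pair that was kept last.
    L : List Pair
    L = proj₁ chain

    uncovered : AllPairs (λ p p′ → ¬ Covers p p′) L
    uncovered = proj₁ (proj₂ chain)

    covered : ∀ i j → ∃ λ p → p ∈ₗ L × Covers (i , j) p
    covered i j = find (All.lookup (proj₂ (proj₂ chain)) (∈-cartesianProduct⁺ (∈-allFin i) (∈-allFin j)))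

    -- A coordinate shared by two kept pairs would make the later one covered by the earlier. Hence
    -- neither list repeats an element, and both sets have exactly as many elements as `L`.
    S′ T′ : FinSubset
    S′ = finSubset (map (s ∘ proj₁) L) (AllPairs.map⁺ (AllPairs.map
           (λ ¬cov eq → ¬cov (inj₁ (_ , ∙-congʳ eq))) uncovered))
    T′ = finSubset (map (t ∘ proj₂) L) (AllPairs.map⁺ (AllPairs.map
           (λ ¬cov eq → ¬cov (inj₂ (_ , ∙-congˡ eq))) uncovered))

    S′⊆S : S′ ⊆ₛ S
    S′⊆S g g∈ = let (i , _) , eq = Any.satisfied (Any.map⁻ g∈) in ∈-resp-≈ setoid (≈-sym eq) (nth-∈ S i)

    T′⊆T : T′ ⊆ₛ T
    T′⊆T g g∈ = let (_ , j) , eq = Any.satisfied (Any.map⁻ g∈) in ∈-resp-≈ setoid (≈-sym eq) (nth-∈ T j)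

    s∈S′ : ∀ {p} → p ∈ₗ L → s (proj₁ p) ∈ₛ S′
    s∈S′ p∈L = Any.map⁺ (lose p∈L ≈-refl)

    t∈T′ : ∀ {p} → p ∈ₗ L → t (proj₂ p) ∈ₛ T′
    t∈T′ p∈L = Any.map⁺ (lose p∈L ≈-refl)

    S′T∪ST′⊆ST : ∀ g → InProd S′ T g ⊎ InProd S T′ g → InProd S T g
    S′T∪ST′⊆ST g (inj₁ (a , b , a∈ , b∈ , eq)) = a , b , S′⊆S a a∈ , b∈ , eq
    S′T∪ST′⊆ST g (inj₂ (a , b , a∈ , b∈ , eq)) = a , b , a∈ , T′⊆T b b∈ , eq

    ST⊆S′T∪ST′ : ∀ g → InProd S T g → InProd S′ T g ⊎ InProd S T′ g
    ST⊆S′T∪ST′ g (a , b , a∈ , b∈ , g≈ab) with covered (index a∈) (index b∈)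
    ... | p , p∈L , inj₁ (j , eq) = inj₁ (_ , _ , s∈S′ p∈L , nth-∈ T j , ≈-trans g≈ab (≈-trans (∙-cong (lookup-index a∈) (lookup-index b∈)) eq))
    ... | p , p∈L , inj₂ (i , eq) = inj₂ (_ , _ , nth-∈ S i , t∈T′ p∈L , ≈-trans g≈ab (≈-trans (∙-cong (lookup-index a∈) (lookup-index b∈)) eq))

    len : ℕ
    len = length L

    σ : Fin len → Fin ∣ S ∣
    σ l = proj₁ (lookup L l)

    τ : Fin len → Fin ∣ T ∣
    τ l = proj₂ (lookup L l)

    -- The vertices x s_l of XS are named by their right translates x s_l t₀, which lie in Z.
    y z : Fin ∣ X ∣ → Fin len → Fin ∣ Z ∣
    y h l = code h (σ l) j₀
    z h l = code h (σ l) (τ l)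

    ¬covers : ∀ {l l′} → l Fin.< l′ → ¬ Covers (lookup L l) (lookup L l′)
    ¬covers = AllPairs-lookup uncovered

    s-injective : ∀ {l l′} → s (σ l) ≈ s (σ l′) → l ≡ l′
    s-injective = ≉-injective (s ∘ σ) λ l<l′ eq → ¬covers l<l′ (inj₁ (_ , ∙-congʳ eq))

    t-injective : ∀ {l l′} → t (τ l) ≈ t (τ l′) → l ≡ l′
    t-injective = ≉-injective (t ∘ τ) λ l<l′ eq → ¬covers l<l′ (inj₂ (_ , ∙-congˡ eq))

    st-injective : ∀ {l l′} → s (σ l) ∙ t (τ l) ≈ s (σ l′) ∙ t (τ l′) → l ≡ l′
    st-injective = ≉-injective (λ l → s (σ l) ∙ t (τ l)) λ l<l′ eq → ¬covers l<l′ (inj₁ (_ , eq))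

    y-reflects : ∀ {h l h′ l′} → y h l ≡ y h′ l′ → x h ∙ s (σ l) ≈ x h′ ∙ s (σ l′)
    y-reflects eq = ∙-cancelʳ (t j₀) _ _ (code-reflects eq)

    y-injective : ∀ h {l l′} → y h l ≡ y h l′ → l ≡ l′
    y-injective h eq = s-injective (∙-cancelˡ (x h) _ _ (y-reflects eq))

    z-injective : ∀ h {l l′} → z h l ≡ z h l′ → l ≡ l′
    z-injective h eq = st-injective (∙-cancelˡ (x h) _ _ (≈-trans (≈-sym (assoc _ _ _)) (≈-trans (code-reflects eq) (assoc _ _ _))))

    -- Equal `y` gives equal products `x s`; cancelling them from the equal products `x s t`
    -- identifies the `t`, hence `l` and `l′`. Cancelling `s` then identifies the `x`.
    yz-injective : ∀ {h l h′ l′} → y h l ≡ y h′ l′ → z h l ≡ z h′ l′ → h ≡ h′ × l ≡ l′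
    yz-injective {h} {l} {h′} {l′} y≡ z≡ =
      nth-injective X (∙-cancelʳ (s (σ l)) _ _ (≈-trans xs≈ (∙-congˡ (reflexive (cong (s ∘ σ) (sym l≡l′)))))) , l≡l′
      where
      xs≈ = y-reflects y≡
      l≡l′ : l ≡ l′
      l≡l′ = t-injective (∙-cancelˡ (x h ∙ s (σ l)) _ _ (≈-trans (code-reflects z≡) (∙-congʳ (≈-sym xs≈))))

    -- Replacing `x h′ ∙ s (σ m)` by `x h ∙ s (σ l′)` in the equality of `z` and cancelling `x h`
    -- leaves `s (σ l) ∙ t (τ l) ≈ s (σ l′) ∙ t (τ m)`: the pair at `l` would be covered by the one
    -- at `l′`, which was kept earlier.
    ordered : ∀ {h l l′ h′ m} → y h′ m ≡ y h l′ → z h′ m ≡ z h l → ¬ (l Fin.< l′)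
    ordered {h} {l} {l′} {h′} {m} y≡ z≡ l<l′ = ¬covers l<l′ (inj₁ (τ m , ∙-cancelˡ (x h) _ _
      (≈-trans (≈-sym (assoc _ _ _)) (≈-trans (≈-sym (code-reflects z≡)) (≈-trans (∙-congʳ (y-reflects y≡)) (assoc _ _ _))))))

    ∣X∣≤∣Z∣ : ∣ X ∣ ≤ ∣ Z ∣
    ∣X∣≤∣Z∣ = Fin.injective⇒≤ {f = λ h → code h i₀ j₀} λ eq →
      nth-injective X (∙-cancelʳ (s i₀) _ _ (∙-cancelʳ (t j₀) _ _ (code-reflects eq)))

    len≤∣Z∣ : len ≤ ∣ Z ∣
    len≤∣Z∣ = Fin.injective⇒≤ (z-injective h₀)

    cover-bound : ∀ l → l ≡ 0 ⊎ threshold l ≤ ∣ Z ∣ → suc l * (∣ X ∣ * len) ≤ ∣ Z ∣ * ∣ Z ∣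
    cover-bound l (inj₂ θ≤) = orderedMatchings-bound y-injective z-injective yz-injective ordered ∣X∣≤∣Z∣ l θ≤
    -- At the default level 0 the claim follows from `∣X∣≤∣Z∣` and `len≤∣Z∣`, whatever the size of
    -- `Z`.
    cover-bound l (inj₁ refl) = ≤-trans (≤-reflexive (*-identityˡ _)) (*-mono-≤ ∣X∣≤∣Z∣ len≤∣Z∣)

    bound : ∀ (A : FinSubset) → ∣ A ∣ ≡ len → Bound (ω ∣ Z ∣) A Z X
    bound A ∣A∣≡len = ℚ-bound (∣ A ∣) (∣ X ∣) (level ∣ Z ∣) (∣ Z ∣)
      (subst (λ a → suc (level ∣ Z ∣) * (∣ X ∣ * a) ≤ ∣ Z ∣ * ∣ Z ∣) (sym ∣A∣≡len)
        (cover-bound (level ∣ Z ∣) (level-from-valid (∣ Z ∣) (∣ Z ∣))))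

  conclusion : Conclusion ω
  conclusion S T X S≢∅ T≢∅ X≢∅ Z Z≡XST =
    S′ , T′ , S′⊆S , T′⊆T , (λ g → S′T∪ST′⊆ST g , ST⊆S′T∪ST′ g) ,
    bound S′ (length-map (s ∘ proj₁) L) , bound T′ (length-map (t ∘ proj₂) L)
    where open Construction S T X S≢∅ T≢∅ X≢∅ Z Z≡XST

theorem5p1 : ∃Omega
theorem5p1 = mkOmega ω ω-nonneg ω-tends λ G → Cover.conclusion G
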